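{- There exists a sequence $(G_n)_{n\in\mathbb{N}}$ of graphs such that $|V(G_n)|=n$ for all $n$, $R_2(G_n)=O(n)$ and $R_3(G_n)=\Omega(n\log n)$.
   Context: For a graph $G$ and integer $r\geqslant 2$, the $r$-colour Ramsey number $R_r(G)$ is the smallest integer $N$ such that every colouring of the edges of the complete graph $K_N$ with $r$ colours contains a copy of $G$ all of whose edges have the same colour. -}

module Defs where

open import Level using (0ℓ)
open import Data.Nat.Base using (ℕ; _*_; _≤_)
open import Data.Fin.Base using (Fin)
open import Data.Product.Base using (_×_; ∃-syntax)
open import Function.Bundles using (_↣_; module Injection)
open import Relation.Binary.Core using (Rel)
open import Relation.Binary.Definitions using (Symmetric; Irreflexive; Decidable)
open import Relation.Binary.PropositionalEquality.Core using (_≡_)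

-- Finite simple graphs, with vertex set Fin ∣V∣.  Decidability of adjacency
-- makes an edge set an actual finite set of pairs; classically it is automatic.
record Graph : Set₁ where
  field
    ∣V∣    : ℕ
    Adj    : Rel (Fin ∣V∣) 0ℓ
    sym    : Symmetric Adj
    irrefl : Irreflexive _≡_ Adj
    adj?   : Decidable Adj

open Graph public using (∣V∣)

-- Colourings of the edges of K_N with r colours.  The edge {i , j} receives the
-- colour `colour i j`; the values on the diagonal are junk, and are never
-- consulted below because graphs are loopless and copies are injective.
record EdgeColouring (r N : ℕ) : Set where
  field
    colour : Fin N → Fin N → Fin r
    sym    : ∀ i j → colour i j ≡ colour j i

-- Copies are not required to be induced.
MonochromaticCopy : ∀ {r N} → Graph → EdgeColouring r N → Set
MonochromaticCopy {r} {N} G χ =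
  ∃[ k ] ∃[ f ] (∀ u v → Adj u v → colour (to f u) (to f v) ≡ k)
  where
  open Graph G using (Adj)
  open EdgeColouring χ using (colour)

  to : (Fin (∣V∣ G) ↣ Fin N) → Fin (∣V∣ G) → Fin N
  to = Injection.to

Arrows : (r N : ℕ) → Graph → Set
Arrows r N G = (χ : EdgeColouring r N) → MonochromaticCopy G χ

-- N = R_r(G).  A relation rather than a function, since totality is Ramsey's
-- theorem; minimality makes N unique.
IsRamseyNumber : (r : ℕ) → Graph → ℕ → Set
IsRamseyNumber r G N = Arrows r N G × (∀ M → Arrows r M G → N ≤ M)

-- For ℕ-valued sequences a natural constant is no restriction: an upper
-- constant may be rounded up, and the lower bound c · g n ≤ f n with real
-- c > 0 may be taken with c = 1 / C.
_=O_ : (f g : ℕ → ℕ) → Set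
f =O g = ∃[ C ] ∃[ n₀ ] (∀ n → n₀ ≤ n → f n ≤ C * g n)

_=Ω_ : (f g : ℕ → ℕ) → Set
f =Ω g = ∃[ C ] ∃[ n₀ ] (∀ n → n₀ ≤ n → g n ≤ C * f n)

{-# OPTIONS --safe #-}

-- Let G be K_{p+1} with pendant edges added at one vertex until that vertex has degree q, plus
-- isolated vertices, where p is of order log n and q ≈ n / p.
--
-- Three colours: take a p × p grid of cells of q vertices each; colour edges inside a cell,
-- between cells of the same row, and between rows, differently.  The components of the first
-- colour are too small for the star and the other two colours are p-partite, so R₃(G) > p²q,
-- which is of order n log n.
--
-- Two colours: if many vertices have degree at most q in some colour c, then greedily discarding
-- c-neighbours among them leaves a clique K_{p+1} in the other colour, in which its vertices have
-- large degree.  Otherwise exponentially many (in p) vertices have degree above q in both colours,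
-- and any monochromatic K_{p+1} among these extends to G.  So R₂(G) = O(pq + 9^p) = O(n).
module Submission where

open import Data.Nat.Base
  using (ℕ; zero; suc; _+_; _*_; _^_; _/_; _%_; _≤_; _<_; z≤n; s≤s; z<s; s<s; NonZero; >-nonZero;
         ⌊_/2⌋; ⌈_/2⌉)
open import Data.Nat.Logarithm using (⌊log₂_⌋; ⌊log₂⌋-mono-≤; ⌊log₂⌊n/2⌋⌋≡⌊log₂n⌋∸1)
open import Data.Product.Base using (Σ-syntax; ∃-syntax; _×_)
open import Relation.Binary.PropositionalEquality.Core using (_≡_)
open import Defs

open import Data.Fin.Base as Fin using (Fin; zero; suc; toℕ; fromℕ<; inject≤; finToFun; funToFin)
import Data.Fin.Properties as Fin
open import Data.List.Base using (List; []; _∷_; _++_; length; filter; map; allFin; lookup)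
open import Data.List.Properties using (length-map; length-tabulate; ++-assoc)
open import Data.List.Membership.Propositional using (_∈_)
open import Data.List.Membership.Propositional.Properties
  using (∈-lookup; ∈-allFin; ∈-filter⁺; ∈-filter⁻; ∈-++⁺ˡ; ∈-++⁺ʳ; ∈-++⁻)
open import Data.List.Relation.Binary.Sublist.Propositional as Sublist
  using (_⊆_; []; _∷_; _∷ʳ_; ⊆-refl; ⊆-trans; minimum)
import Data.List.Relation.Binary.Sublist.Propositional.Properties as Sublist
open import Data.List.Relation.Unary.All as All using (All; []; _∷_)
import Data.List.Relation.Unary.All.Properties as All
open import Data.List.Relation.Unary.AllPairs as AllPairs using (AllPairs; []; _∷_)
import Data.List.Relation.Unary.AllPairs.Properties as AllPairs
open import Data.List.Relation.Unary.Any as Any using (here; there)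
open import Data.List.Relation.Unary.Any.Properties using (lookup-index)
open import Data.List.Relation.Unary.Unique.Propositional using (Unique)
import Data.List.Relation.Unary.Unique.Propositional.Properties as Unique
open import Data.Nat.DivMod
open import Data.Nat.Induction using (<-rec)
open import Data.Nat.Properties
open import Data.Nat.Solver using (module +-*-Solver)
open import Data.Product.Base using (_,_; proj₁; proj₂; map₂)
open import Data.Sum.Base using (_⊎_; inj₁; inj₂; [_,_]′)
import Data.List.Membership.DecPropositional as DecMembership
open import Function.Base using (_∘_; id; it)
open import Function.Bundles using (mk↣; module Injection)
open import Function.Definitions using (Injective)
open import Level using (0ℓ)
open import Relation.Binary.Core using (Rel)
open import Relation.Binary.Definitions using (Symmetric)
open import Relation.Binary.PropositionalEquality
  using (_≢_; _≗_; refl; sym; trans; cong; cong₂; subst; subst₂; ≢-sym)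
open import Relation.Nullary using (¬_; Dec; yes; no; contradiction)
open import Relation.Nullary.Decidable using (map′; _×-dec_; _→-dec_; _⊎-dec_; ¬?; decidable-stable)
open import Relation.Unary using (Decidable)

-- Lists

module _ {A : Set} where

  AllPairs-resp-⊆ : ∀ {R : Rel A 0ℓ} {xs ys} → xs ⊆ ys → AllPairs R ys → AllPairs R xs
  AllPairs-resp-⊆ []         []         = []
  AllPairs-resp-⊆ (_ ∷ʳ τ)   (_ ∷ rys)  = AllPairs-resp-⊆ τ rys
  AllPairs-resp-⊆ (refl ∷ τ) (ry ∷ rys) = Sublist.All-resp-⊆ τ ry ∷ AllPairs-resp-⊆ τ rys

  All-lookup : ∀ {P : A → Set} {xs} → All P xs → ∀ i → P (lookup xs i)
  All-lookup pxs i = All.lookup pxs (∈-lookup i)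

  AllPairs-lookup : ∀ {R : Rel A 0ℓ} {xs} → Symmetric R → AllPairs R xs →
                    ∀ {i j} → i ≢ j → R (lookup xs i) (lookup xs j)
  AllPairs-lookup s (rx ∷ rxs) {zero}  {zero}  i≢j = contradiction refl i≢j
  AllPairs-lookup s (rx ∷ rxs) {zero}  {suc j} i≢j = All-lookup rx j
  AllPairs-lookup s (rx ∷ rxs) {suc i} {zero}  i≢j = s (All-lookup rx i)
  AllPairs-lookup s (rx ∷ rxs) {suc i} {suc j} i≢j = AllPairs-lookup s rxs (i≢j ∘ cong suc)

  AllPairs-mapˡ : ∀ {P : A → Set} {R S : Rel A 0ℓ} {xs} → (∀ {x y} → P x → R x y → S x y) →
                  All P xs → AllPairs R xs → AllPairs S xs
  AllPairs-mapˡ f []         []         = []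
  AllPairs-mapˡ f (px ∷ pxs) (rx ∷ rxs) = All.map (f px) rx ∷ AllPairs-mapˡ f pxs rxs

  lookup-++-< : ∀ (xs : List A) {ys} i (i< : toℕ i < length xs) →
                lookup (xs ++ ys) i ≡ lookup xs (fromℕ< i<)
  lookup-++-< (x ∷ xs) zero    _        = refl
  lookup-++-< (x ∷ xs) (suc i) (s<s i<) = lookup-++-< xs i i<

  -- The splitting is taken as an equation because `extend` cuts one list at two places: `zs` is
  -- built as `core ++ others`, and is regrouped to expose the clique as a prefix.
  All-lookup-prefix : ∀ {P : A → Set} {xs ys zs} → zs ≡ xs ++ ys → All P xs →
                      ∀ i → toℕ i < length xs → P (lookup zs i)
  All-lookup-prefix {P} {xs} refl pxs i i< = subst P (sym (lookup-++-< xs i i<)) (All-lookup pxs _)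

  AllPairs-lookup-prefix : ∀ {R : Rel A 0ℓ} {xs ys zs} → zs ≡ xs ++ ys → Symmetric R → AllPairs R xs →
                           ∀ {i j} → i ≢ j → toℕ i < length xs → toℕ j < length xs →
                           R (lookup zs i) (lookup zs j)
  AllPairs-lookup-prefix {R} {xs} refl s rxs {i} {j} i≢j i< j< =
    subst₂ R (sym (lookup-++-< xs i i<)) (sym (lookup-++-< xs j j<))
      (AllPairs-lookup s rxs (i≢j ∘ Fin.toℕ-injective ∘ Fin.fromℕ<-injective _ _ i< j<))

  Unique-lookup-injective : ∀ {xs : List A} → Unique xs → Injective _≡_ _≡_ (lookup xs)
  Unique-lookup-injective xs! {i} {j} eq =
    decidable-stable (i Fin.≟ j) λ i≢j → AllPairs-lookup ≢-sym xs! i≢j eq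

  -- Each position in `xs` is sent to a position of the same entry in `ys`. This map is injective
  -- because `xs` has no repetitions.
  Unique⇒length≤ : ∀ {xs ys : List A} → Unique xs → (∀ {x} → x ∈ xs → x ∈ ys) →
                   length xs ≤ length ys
  Unique⇒length≤ {xs} {ys} xs! sub = Fin.injective⇒≤ {f = f} λ {i} {j} eq →
    Unique-lookup-injective xs!
      (trans (lookup-f i) (trans (cong (lookup ys) eq) (sym (lookup-f j))))
    where
    f : Fin (length xs) → Fin (length ys)
    f i = Any.index (sub (∈-lookup i))

    lookup-f : ∀ i → lookup xs i ≡ lookup ys (f i)
    lookup-f i = lookup-index (sub (∈-lookup i))

  length-filter-∁ : ∀ {P : A → Set} (P? : Decidable P) xs →
                    length xs ≡ length (filter P? xs) + length (filter (¬? ∘ P?) xs)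
  length-filter-∁ P? []       = refl
  length-filter-∁ P? (x ∷ xs) with P? x
  ... | yes _ = cong suc (length-filter-∁ P? xs)
  ... | no  _ = trans (cong suc (length-filter-∁ P? xs)) (sym (+-suc _ _))

  -- The left alternative is strict: in the pigeonhole argument it yields more than `a` hits, and in
  -- the greedy argument it contradicts a degree bound of `a`.
  filter-split : ∀ {P : A → Set} (P? : Decidable P) xs {a b} → a + b ≤ length xs →
                 a < length (filter P? xs) ⊎ b ≤ length (filter (¬? ∘ P?) xs)
  filter-split P? xs {a} {b} a+b≤ with a <? length (filter P? xs)
  ... | yes a< = inj₁ a<
  ... | no  a≮ = inj₂ (+-cancelˡ-≤ a _ _ (begin
    a + b                                                 ≤⟨ a+b≤ ⟩
    length xs                                             ≡⟨ length-filter-∁ P? xs ⟩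
    length (filter P? xs) + length (filter (¬? ∘ P?) xs)  ≤⟨ +-monoˡ-≤ _ (≮⇒≥ a≮) ⟩
    a + length (filter (¬? ∘ P?) xs)                      ∎))
    where open ≤-Reasoning

  length-filter-mono : ∀ {P : A → Set} (P? : Decidable P) {xs ys} → xs ⊆ ys →
                       length (filter P? xs) ≤ length (filter P? ys)
  length-filter-mono P? τ =
    Sublist.length-mono-≤ (Sublist.filter⁺ P? P? (λ { refl → id }) τ)

  -- Induction on the list of colours still possible: either `c` occurs more than `k` times, or
  -- removing its occurrences leaves enough entries for the colours in `cs`.
  pigeonhole-∈ : ∀ {r} (f : A → Fin r) cs xs {k} → (∀ {x} → x ∈ xs → f x ∈ cs) →
                 length cs * k < length xs →
                 ∃[ c ] k < length (filter (λ x → f x Fin.≟ c) xs)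
  pigeonhole-∈ f []       (x ∷ xs) sub _ = contradiction (sub (here refl)) λ ()
  pigeonhole-∈ f (c ∷ cs) xs {k} sub h
    with filter-split (λ x → f x Fin.≟ c) xs (≤-trans (≤-reflexive (+-suc k _)) h)
  ... | inj₁ k<   = c , k<
  ... | inj₂ rest = map₂ (λ k< → <-≤-trans k< (length-filter-mono _ (Sublist.filter-⊆ _ xs)))
                         (pigeonhole-∈ f cs _ sub′ rest)
    where
    sub′ : ∀ {x} → x ∈ filter (λ x → ¬? (f x Fin.≟ c)) xs → f x ∈ cs
    sub′ x∈ with ∈-filter⁻ (λ x → ¬? (f x Fin.≟ c)) {xs = xs} x∈
    ... | x∈xs , fx≢c with sub x∈xs
    ...   | here fx≡c = contradiction fx≡c fx≢c
    ...   | there fx∈ = fx∈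

  pigeonhole : ∀ {r} (f : A → Fin (suc r)) xs k → suc r * k ≤ length xs →
               ∃[ c ] k ≤ length (filter (λ x → f x Fin.≟ c) xs)
  pigeonhole     f xs zero    _ = zero , z≤n
  pigeonhole {r} f xs (suc k) h = pigeonhole-∈ f (allFin (suc r)) xs (λ _ → ∈-allFin _) (begin-strict
    length (allFin (suc r)) * k  ≡⟨ cong (_* k) (length-tabulate {n = suc r} id) ⟩
    suc r * k                    <⟨ *-monoʳ-< (suc r) (n<1+n k) ⟩
    suc r * suc k                ≤⟨ h ⟩
    length xs                    ∎)
    where open ≤-Reasoning

-- Ramsey's theorem

module _ {A : Set} {r} (col : A → A → Fin (suc r)) where

  -- The colour of an edge of a prehomogeneous sequence depends only on its first vertex.
  prehomogeneous : ∀ l xs → (2 + r) ^ l ≤ length xs →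
    ∃[ ps ] length ps ≡ l × map proj₁ ps ⊆ xs
          × AllPairs (λ (u , c) (v , _) → col u v ≡ c) ps
  prehomogeneous zero    xs       _ = [] , refl , minimum xs , []
  prehomogeneous (suc l) []       h = contradiction (≤-trans (m^n>0 (2 + r) (suc l)) h) λ ()
  -- The base is `2 + r` because `(2 + r) ^ suc l` consists of a share `(2 + r) ^ l` for each of the
  -- `suc r` colours and one further share, at least 1, that pays for `v`.
  prehomogeneous (suc l) (v ∷ xs) h with pigeonhole (col v) xs ((2 + r) ^ l)
    (≤-pred (≤-trans (+-monoˡ-≤ _ (m^n>0 (2 + r) l)) h))
  ... | c , large with prehomogeneous l _ large
  ...   | ps , len , sub , pre =
    (v , c) ∷ ps , cong suc len , refl ∷ ⊆-trans sub (Sublist.filter-⊆ _ xs)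
    , All.map⁻ (Sublist.All-resp-⊆ sub (All.all-filter (λ w → col v w Fin.≟ c) xs)) ∷ pre

  Clique : Fin (suc r) → List A → Set
  Clique c = AllPairs (λ u v → col u v ≡ c)

  -- In a prehomogeneous sequence of length `suc r * k` some colour is attached to at least `k`
  -- vertices, and these span a clique of that colour.
  ramsey : ∀ k xs → (2 + r) ^ (suc r * k) ≤ length xs →
           ∃[ c ] ∃[ ys ] k ≤ length ys × ys ⊆ xs × Clique c ys
  ramsey k xs h with prehomogeneous (suc r * k) xs h
  ... | ps , len , sub , pre with pigeonhole proj₂ ps k (≤-reflexive (sym len))
  ...   | c , large = c , map proj₁ qs , subst (k ≤_) (sym (length-map proj₁ qs)) large
                    , ⊆-trans (Sublist.map⁺ proj₁ (Sublist.filter-⊆ _ ps)) sub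
                    , AllPairs.map⁺ (AllPairs-mapˡ (λ { refl eq → eq })
                        (All.all-filter _ ps) (AllPairs.filter⁺ _ pre))
    where qs = filter (λ p → proj₂ p Fin.≟ c) ps

  -- Each chosen vertex costs itself and at most `q` neighbours, hence the factor `suc q`. Degrees
  -- are counted in the fixed list `zs`, so their bound survives as `xs` shrinks.
  sparse⇒avoiding : ∀ c q k zs xs → xs ⊆ zs →
    All (λ v → length (filter (λ w → col v w Fin.≟ c) zs) ≤ q) xs →
    k * suc q ≤ length xs →
    ∃[ ys ] k ≤ length ys × ys ⊆ xs × AllPairs (λ u v → col u v ≢ c) ys
  sparse⇒avoiding c q zero    zs xs       τ _        _ = [] , z≤n , minimum xs , []
  sparse⇒avoiding c q (suc k) zs (v ∷ xs) τ (d ∷ ds) (s≤s h)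
    with filter-split (λ w → col v w Fin.≟ c) xs h
  ... | inj₁ q< = contradiction
    (≤-trans q< (≤-trans (length-filter-mono _ (Sublist.∷ˡ⁻ τ)) d)) (n≮n q)
  ... | inj₂ rest with sparse⇒avoiding c q k zs _ (⊆-trans (Sublist.filter-⊆ _ xs) (Sublist.∷ˡ⁻ τ))
                         (Sublist.All-resp-⊆ (Sublist.filter-⊆ _ xs) ds) rest
  ...   | ys , k≤ , σ , avoid =
    v ∷ ys , s≤s k≤ , refl ∷ ⊆-trans σ (Sublist.filter-⊆ _ xs)
    , Sublist.All-resp-⊆ σ (All.all-filter (λ w → ¬? (col v w Fin.≟ c)) xs) ∷ avoid

-- Existence of Ramsey numbers

-- The search runs over the finitely many codes of functions. Decoding a code recovers a function
-- only pointwise, so `P` must respect `≗`.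
any-function? : ∀ {m n} {P : (Fin m → Fin n) → Set} →
                (∀ {f g} → f ≗ g → P f → P g) → Decidable P → Dec (∃[ f ] P f)
any-function? resp P? = map′
  (λ (c , p) → finToFun c , p)
  (λ (f , p) → funToFin f , resp (sym ∘ Fin.finToFun-funToFin f) p)
  (Fin.any? (P? ∘ finToFun))

least : ∀ {P : ℕ → Set} → Decidable P → ∀ n → P n →
        ∃[ m ] P m × (∀ j → P j → m ≤ j)
least P? n p with P? 0
... | yes p₀ = 0 , p₀ , λ _ _ → z≤n
least P? zero    p | no ¬p₀ = contradiction p ¬p₀
least P? (suc n) p | no ¬p₀ with least (P? ∘ suc) n p
... | m , pm , min = suc m , pm , λ where
  zero    p₀ → contradiction p₀ ¬p₀
  (suc j) pj → s≤s (min j pj)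

module _ (G : Graph) where
  open Graph G using (Adj; adj?)

  module _ {r N} (χ : EdgeColouring r N) where
    open EdgeColouring χ using (colour)

    -- The injection is unbundled into a bare function and two decidable properties, so that the
    -- search can run over functions.
    Copy : Fin r → (Fin (∣V∣ G) → Fin N) → Set
    Copy k f = (∀ i j → f i ≡ f j → i ≡ j) × (∀ u v → Adj u v → colour (f u) (f v) ≡ k)

    Copy-resp : ∀ {k f g} → f ≗ g → Copy k f → Copy k g
    Copy-resp f≗g (inj , mono) =
      (λ i j eq → inj i j (trans (f≗g i) (trans eq (sym (f≗g j))))) ,
      (λ u v a → trans (sym (cong₂ colour (f≗g u) (f≗g v))) (mono u v a))

    copy? : ∀ k → Decidable (Copy k)
    copy? k f =
      Fin.all? (λ i → Fin.all? λ j → f i Fin.≟ f j →-dec i Fin.≟ j) ×-dec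
      Fin.all? (λ u → Fin.all? λ v → adj? u v →-dec colour (f u) (f v) Fin.≟ k)

    monochromaticCopy? : Dec (MonochromaticCopy G χ)
    monochromaticCopy? = map′
      (λ (k , f , inj , mono) → k , mk↣ {to = f} (λ {i} {j} → inj i j) , mono)
      (λ (k , f , mono) → k , Injection.to f , (λ i j → Injection.injective f) , mono)
      (Fin.any? λ k → any-function? Copy-resp (copy? k))

  MonochromaticCopy-resp : ∀ {r N} (χ χ′ : EdgeColouring r N) →
    (∀ i j → EdgeColouring.colour χ i j ≡ EdgeColouring.colour χ′ i j) →
    MonochromaticCopy G χ → MonochromaticCopy G χ′
  MonochromaticCopy-resp χ χ′ eq (k , f , mono) = k , f , λ u v a → trans (sym (eq _ _)) (mono u v a)

  -- Colour tables are numbered by `Fin ((r ^ N) ^ N)`, which makes the quantifier over colourings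
  -- finite. A table need not be symmetric; one that is not encodes no colouring and satisfies the
  -- condition vacuously.
  arrows? : ∀ r N → Dec (Arrows r N G)
  arrows? r N = map′
    (λ h χ → fromDecoded χ (h (encode (EdgeColouring.colour χ))))
    (λ h x s → h (colouring x s))
    (Fin.all? everyDecoded?)
    where
    decode : Fin ((r ^ N) ^ N) → Fin N → Fin N → Fin r
    decode x i = finToFun (finToFun x i)

    encode : (Fin N → Fin N → Fin r) → Fin ((r ^ N) ^ N)
    encode g = funToFin (funToFin ∘ g)

    decode-encode : ∀ g i j → decode (encode g) i j ≡ g i j
    decode-encode g i j = trans
      (cong (λ y → finToFun y j) (Fin.finToFun-funToFin (funToFin ∘ g) i))
      (Fin.finToFun-funToFin (g i) j)

    colouring : ∀ x → (∀ i j → decode x i j ≡ decode x j i) → EdgeColouring r N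
    colouring x s = record { colour = decode x ; sym = s }

    fromDecoded : ∀ χ → (∀ s → MonochromaticCopy G (colouring (encode (EdgeColouring.colour χ)) s)) →
                  MonochromaticCopy G χ
    fromDecoded χ h = MonochromaticCopy-resp (colouring (encode colour) s) χ (decode-encode colour) (h s)
      where
      open EdgeColouring χ using (colour) renaming (sym to colour-sym)
      s : ∀ i j → decode (encode colour) i j ≡ decode (encode colour) j i
      s i j = trans (decode-encode colour i j)
                (trans (colour-sym i j) (sym (decode-encode colour j i)))

    everyDecoded? : ∀ x → Dec (∀ s → MonochromaticCopy G (colouring x s))
    everyDecoded? x with Fin.all? (λ i → Fin.all? λ j → decode x i j Fin.≟ decode x j i)
    ... | no ¬s = yes λ s → contradiction s ¬s
    -- The copy found for `s` serves any other symmetry proof `s′`, since the colours are the same.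
    ... | yes s = map′
      (λ copy s′ → MonochromaticCopy-resp (colouring x s) (colouring x s′) (λ _ _ → refl) copy)
      (λ h → h s)
      (monochromaticCopy? (colouring x s))

  -- A monochromatic clique on as many vertices as `G` contains `G`, whatever its edges are.
  ramsey-arrows : ∀ r → Arrows (suc r) ((2 + r) ^ (suc r * ∣V∣ G)) G
  ramsey-arrows r χ =
    let c , ys , n≤ , ys⊆ , clique = ramsey colour (∣V∣ G) (allFin _) (≤-reflexive (sym (length-tabulate id)))
        f = λ i → lookup ys (inject≤ i n≤)
        f-injective = λ {i} {j} eq → Fin.inject≤-injective n≤ n≤ i j
          (Unique-lookup-injective (AllPairs-resp-⊆ ys⊆ (Unique.allFin⁺ _)) eq)
    in c , mk↣ {to = f} f-injective ,
       λ u v a → AllPairs-lookup (λ eq → trans (colour-sym _ _) eq) clique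
         λ eq → irrefl (Fin.inject≤-injective n≤ n≤ u v eq) a
    where
    open EdgeColouring χ using (colour) renaming (sym to colour-sym)
    open Graph G using (irrefl)

  ramseyNumber : ∀ r → ∃[ N ] IsRamseyNumber (suc r) G N
  ramseyNumber r = least (arrows? (suc r)) _ (ramsey-arrows r)

-- Cliques with a star

-- The cases are the clique on 0,...,p and the star at 0, the latter in both directions for
-- symmetry. Equal numbers may be joined here; `starredClique` removes the loops.
Joined : (p q : ℕ) → ℕ → ℕ → Set
Joined p q a b = (a ≤ p × b ≤ p) ⊎ (a ≡ 0 × b ≤ q) ⊎ (a ≤ q × b ≡ 0)

joined-sym : ∀ {p q} → Symmetric (Joined p q)
joined-sym (inj₁ (a , b))        = inj₁ (b , a)
joined-sym (inj₂ (inj₁ (a , b))) = inj₂ (inj₂ (b , a))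
joined-sym (inj₂ (inj₂ (a , b))) = inj₂ (inj₁ (b , a))

joined? : ∀ p q a b → Dec (Joined p q a b)
joined? p q a b =
  (a ≤? p ×-dec b ≤? p) ⊎-dec (a ≟ 0 ×-dec b ≤? q) ⊎-dec (a ≤? q ×-dec b ≟ 0)

-- For p ≤ q: a clique on 0,…,p, pendant edges joining 0 to p+1,…,q, and isolated vertices.
starredClique : (p q n : ℕ) → Graph
starredClique p q n = record
  { ∣V∣    = n
  ; Adj    = λ u v → u ≢ v × Joined p q (toℕ u) (toℕ v)
  ; sym    = λ (u≢v , j) → ≢-sym u≢v , joined-sym j
  ; irrefl = λ u≡v (u≢v , _) → u≢v u≡v
  ; adj?   = λ u v → ¬? (u Fin.≟ v) ×-dec joined? p q (toℕ u) (toℕ v)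
  }

-- Two colours

module TwoColours {p q n N : ℕ} (χ : EdgeColouring 2 N) where
  open EdgeColouring χ using (colour) renaming (sym to colour-sym)

  open DecMembership (Fin._≟_ {N}) using (_∈?_)

  -- The junk value `colour v v` is counted too, so `q < degree c v` guarantees at least `q` genuine
  -- neighbours.
  degree : Fin 2 → Fin N → ℕ
  degree c v = length (filter (λ w → colour v w Fin.≟ c) (allFin N))

  -- All vertices of the host are listed as `v`, the rest of the clique, the remaining
  -- `c`-neighbours of `v`, then everything else; vertex `i` of the graph goes to entry `i`. The
  -- clique fills positions 0,...,p, and `core` is long enough for the star at `v` to fill 0,...,q.
  extend : ∀ c ys → n ≤ N → ys ⊆ allFin N → p < length ys → Clique colour c ys →
           All (λ v → q < degree c v) ys → MonochromaticCopy (starredClique p q n) χ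
  extend c (v ∷ ys) n≤N ys⊆ (s≤s p≤) (v∼ys ∷ ys∼) (q< ∷ _) = c , mk↣ {to = f} f-injective , mono
    where
    ys! : Unique (v ∷ ys)
    ys! = AllPairs-resp-⊆ ys⊆ (Unique.allFin⁺ N)

    unused? : Decidable (λ w → ¬ (w ∈ (v ∷ ys)))
    unused? w = ¬? (w ∈? (v ∷ ys))

    rest leaves core others zs : List (Fin N)
    rest   = filter unused? (allFin N)
    leaves = filter (λ w → colour v w Fin.≟ c) rest
    core   = v ∷ ys ++ leaves
    others = filter (λ w → ¬? (colour v w Fin.≟ c)) rest
    zs     = core ++ others

    rest! : Unique rest
    rest! = Unique.filter⁺ unused? (Unique.allFin⁺ N)

    zs! : Unique zs
    zs! = Unique.++⁺ (Unique.++⁺ ys! (Unique.filter⁺ _ rest!) ys∩leaves) (Unique.filter⁺ _ rest!) core∩others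
      where
      rest∌ : ∀ {w} → w ∈ rest → ¬ (w ∈ (v ∷ ys))
      rest∌ w∈ = proj₂ (∈-filter⁻ unused? {xs = allFin N} w∈)

      ys∩leaves : ∀ {w} → ¬ (w ∈ (v ∷ ys) × w ∈ leaves)
      ys∩leaves (w∈ys , w∈) = rest∌ (proj₁ (∈-filter⁻ _ {xs = rest} w∈)) w∈ys

      core∩others : ∀ {w} → ¬ (w ∈ core × w ∈ others)
      core∩others (w∈core , w∈)
        with ∈-filter⁻ (λ w → ¬? (colour v w Fin.≟ c)) {xs = rest} w∈ | ∈-++⁻ (v ∷ ys) w∈core
      ... | w∈rest , _   | inj₁ w∈ys     = rest∌ w∈rest w∈ys
      ... | _      , w≁v | inj₂ w∈leaves =
        w≁v (proj₂ (∈-filter⁻ (λ w → colour v w Fin.≟ c) {xs = rest} w∈leaves))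

    -- The second alternative records `colour v w ≢ c`, so this shows both that `zs` exhausts the
    -- host and that every `c`-neighbour of `v` lies in `core`.
    ∈zs : ∀ w → w ∈ core ⊎ w ∈ others × colour v w ≢ c
    ∈zs w with w ∈? (v ∷ ys) | colour v w Fin.≟ c
    ... | yes w∈ | _       = inj₁ (∈-++⁺ˡ w∈)
    ... | no  w∉ | yes w∼v = inj₁ (∈-++⁺ʳ (v ∷ ys) (∈-filter⁺ _ (∈-filter⁺ unused? (∈-allFin w) w∉) w∼v))
    ... | no  w∉ | no  w≁v = inj₂ (∈-filter⁺ _ (∈-filter⁺ unused? (∈-allFin w) w∉) w≁v , w≁v)

    N≤ : N ≤ length zs
    N≤ = subst (_≤ length zs) (length-tabulate id)
      (Unique⇒length≤ (Unique.allFin⁺ N) λ {w} _ → [ ∈-++⁺ˡ , ∈-++⁺ʳ core ∘ proj₁ ]′ (∈zs w))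

    q<core : q < length core
    q<core = <-≤-trans q< (Unique⇒length≤ (Unique.filter⁺ _ (Unique.allFin⁺ N)) λ {w} w∈ →
      [ id , (λ (_ , w≁v) → contradiction (proj₂ (∈-filter⁻ _ {xs = allFin N} w∈)) w≁v) ]′ (∈zs w))

    n≤ : n ≤ length zs
    n≤ = ≤-trans n≤N N≤

    f : Fin n → Fin N
    f i = lookup zs (inject≤ i n≤)

    f-injective : Injective _≡_ _≡_ f
    f-injective eq = Fin.inject≤-injective n≤ n≤ _ _ (Unique-lookup-injective zs! eq)

    leaf : ∀ j → zero ≢ j → toℕ j ≤ q → colour v (lookup zs j) ≡ c
    leaf zero    0≢j _  = contradiction refl 0≢j
    leaf (suc j) _   j≤ = All-lookup-prefix refl (All.++⁺ v∼ys (All.all-filter _ rest))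
      j (≤-pred (≤-trans (s≤s j≤) q<core))

    joined⇒c : ∀ i j → i ≢ j → Joined p q (toℕ i) (toℕ j) → colour (lookup zs i) (lookup zs j) ≡ c
    joined⇒c i    j    i≢j (inj₁ (i≤ , j≤)) = AllPairs-lookup-prefix (++-assoc (v ∷ ys) leaves others)
      (λ eq → trans (colour-sym _ _) eq) (v∼ys ∷ ys∼) i≢j (s≤s (≤-trans i≤ p≤)) (s≤s (≤-trans j≤ p≤))
    joined⇒c zero j    i≢j (inj₂ (inj₁ (_ , j≤))) = leaf j i≢j j≤
    joined⇒c i    zero i≢j (inj₂ (inj₂ (i≤ , _))) = trans (colour-sym _ v) (leaf i (≢-sym i≢j) i≤)

    mono : ∀ u w → u ≢ w × Joined p q (toℕ u) (toℕ w) → colour (f u) (f w) ≡ c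
    mono u w (u≢w , j) = joined⇒c _ _ (u≢w ∘ Fin.inject≤-injective n≤ n≤ u w)
      (subst₂ (Joined p q) (sym (Fin.toℕ-inject≤ u n≤)) (sym (Fin.toℕ-inject≤ w n≤)) j)

  private
    ≢⇒≡opposite : ∀ {c d : Fin 2} → d ≢ c → d ≡ Fin.opposite c
    ≢⇒≡opposite {zero}     {zero}     d≢c = contradiction refl d≢c
    ≢⇒≡opposite {zero}     {suc zero} _   = refl
    ≢⇒≡opposite {suc zero} {zero}     _   = refl
    ≢⇒≡opposite {suc zero} {suc zero} d≢c = contradiction refl d≢c

  degree-sum : ∀ c v → N ≤ degree c v + degree (Fin.opposite c) v
  degree-sum c v = begin
    N
      ≡⟨ length-tabulate id ⟨
    length (allFin N)
      ≡⟨ length-filter-∁ (λ w → colour v w Fin.≟ c) (allFin N) ⟩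
    degree c v + length (filter (λ w → ¬? (colour v w Fin.≟ c)) (allFin N))
      ≤⟨ +-monoʳ-≤ (degree c v) (Sublist.length-mono-≤
           (Sublist.filter⁺ _ _ (λ { refl → ≢⇒≡opposite }) (⊆-refl {x = allFin N}))) ⟩
    degree c v + degree (Fin.opposite c) v
      ∎
    where open ≤-Reasoning

  module _ (n≤N : n ≤ N) (N-large : suc p * suc q + (suc p * suc q + 3 ^ (2 * suc p)) ≤ N) where

    2q<N : q + q < N
    2q<N = ≤-trans (+-mono-≤ (m≤n*m (suc q) (suc p))
      (≤-trans (n≤1+n q) (≤-trans (m≤n*m (suc q) (suc p)) (m≤m+n _ _)))) N-large

    -- Avoiding `c` means having the opposite colour throughout, and as `N` exceeds `2q`, a vertex
    -- of degree at most `q` in `c` has degree above `q` in the opposite colour.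
    light : ∀ c xs → xs ⊆ allFin N → All (λ v → degree c v ≤ q) xs →
            suc p * suc q ≤ length xs → MonochromaticCopy (starredClique p q n) χ
    light c xs xs⊆ sparse h with sparse⇒avoiding colour c q (suc p) (allFin N) xs xs⊆ sparse h
    ... | ys , p< , ys⊆ , avoid = extend (Fin.opposite c) ys n≤N (⊆-trans ys⊆ xs⊆) p<
      (AllPairs.map ≢⇒≡opposite avoid) (All.map heavy (Sublist.All-resp-⊆ ys⊆ sparse))
      where
      heavy : ∀ {v} → degree c v ≤ q → q < degree (Fin.opposite c) v
      heavy {v} d≤ = +-cancelˡ-< q _ _ (<-≤-trans 2q<N (≤-trans (degree-sum c v) (+-monoˡ-≤ _ d≤)))

    light? : ∀ c → Decidable (λ v → degree c v ≤ q)
    light? c v = degree c v ≤? q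

    heavy? : ∀ c → Decidable (λ v → ¬ (degree c v ≤ q))
    heavy? c = ¬? ∘ light? c

    light₀ heavy₀ light₁ heavy₀₁ : List (Fin N)
    light₀  = filter (light? zero) (allFin N)
    heavy₀  = filter (heavy? zero) (allFin N)
    light₁  = filter (light? (suc zero)) heavy₀
    heavy₀₁ = filter (heavy? (suc zero)) heavy₀

    heavy₀⊆ : heavy₀ ⊆ allFin N
    heavy₀⊆ = Sublist.filter-⊆ (heavy? zero) (allFin N)

    heavy₀₁⊆ : heavy₀₁ ⊆ heavy₀
    heavy₀₁⊆ = Sublist.filter-⊆ (heavy? (suc zero)) heavy₀

    heavy₀₁-heavy : ∀ c → All (λ v → q < degree c v) heavy₀₁
    heavy₀₁-heavy zero       =
      Sublist.All-resp-⊆ heavy₀₁⊆ (All.map ≰⇒> (All.all-filter (heavy? zero) (allFin N)))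
    heavy₀₁-heavy (suc zero) = All.map ≰⇒> (All.all-filter (heavy? (suc zero)) heavy₀)

    -- The summands of `N-large` match the three outcomes: enough light vertices in colour 0, enough
    -- in colour 1, or enough doubly heavy ones for the two-colour case of `ramsey`.
    copy : MonochromaticCopy (starredClique p q n) χ
    copy with filter-split (light? zero) (allFin N) (subst (_ ≤_) (sym (length-tabulate id)) N-large)
    ... | inj₁ large = light zero light₀ (Sublist.filter-⊆ (light? zero) _)
      (All.all-filter (light? zero) (allFin N)) (<⇒≤ large)
    ... | inj₂ large₀ with filter-split (light? (suc zero)) heavy₀ large₀
    ...   | inj₁ large = light (suc zero) light₁ (⊆-trans (Sublist.filter-⊆ (light? (suc zero)) heavy₀) heavy₀⊆)
      (All.all-filter (light? (suc zero)) heavy₀) (<⇒≤ large)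
    ...   | inj₂ large with ramsey colour (suc p) heavy₀₁ large
    ...     | c , ys , p< , ys⊆ , clique = extend c ys n≤N (⊆-trans ys⊆ (⊆-trans heavy₀₁⊆ heavy₀⊆)) p< clique
      (Sublist.All-resp-⊆ ys⊆ (heavy₀₁-heavy c))

-- Three colours

/%-injective : ∀ {x y} d .{{_ : NonZero d}} → x / d ≡ y / d → x % d ≡ y % d → x ≡ y
/%-injective {x} {y} d x/≡y/ x%≡y% =
  trans (m≡m%n+[m/n]*n x d)
    (trans (cong₂ (λ r t → r + t * d) x%≡y% x/≡y/) (sym (m≡m%n+[m/n]*n y d)))

bounded-collision : ∀ d (g : Fin (suc d) → ℕ) → (∀ i → g i < d) →
                    ∃[ i ] ∃[ j ] i ≢ j × g i ≡ g j
bounded-collision d g g< with Fin.pigeonhole (n<1+n d) (λ i → fromℕ< (g< i))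
... | i , j , i<j , eq = i , j , Fin.<⇒≢ i<j , Fin.fromℕ<-injective _ _ (g< i) (g< j) eq

firstOf : ∀ {A B : Set} → Dec A → Dec B → Fin 3
firstOf (yes _) _       = zero
firstOf (no _)  (yes _) = suc zero
firstOf (no _)  (no _)  = suc (suc zero)

firstOf-cong : ∀ {A A′ B B′ : Set} (a? : Dec A) (a′? : Dec A′) (b? : Dec B) (b′? : Dec B′) →
               (A → A′) → (A′ → A) → (B → B′) → (B′ → B) → firstOf a? b? ≡ firstOf a′? b′?
firstOf-cong (yes a) (yes _)  _       _        f f⁻ g g⁻ = refl
firstOf-cong (yes a) (no ¬a)  _       _        f f⁻ g g⁻ = contradiction (f a) ¬a
firstOf-cong (no ¬a) (yes a)  _       _        f f⁻ g g⁻ = contradiction (f⁻ a) ¬a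
firstOf-cong (no _)  (no _)   (yes _) (yes _)  f f⁻ g g⁻ = refl
firstOf-cong (no _)  (no _)   (yes b) (no ¬b)  f f⁻ g g⁻ = contradiction (g b) ¬b
firstOf-cong (no _)  (no _)   (no ¬b) (yes b)  f f⁻ g g⁻ = contradiction (g⁻ b) ¬b
firstOf-cong (no _)  (no _)   (no _)  (no _)   f f⁻ g g⁻ = refl

firstOf≡0 : ∀ {A B : Set} (a? : Dec A) (b? : Dec B) → firstOf a? b? ≡ zero → A
firstOf≡0 (yes a) _       _ = a
firstOf≡0 (no _)  (yes _) ()
firstOf≡0 (no _)  (no _)  ()

firstOf≡1 : ∀ {A B : Set} (a? : Dec A) (b? : Dec B) → firstOf a? b? ≡ suc zero → ¬ A × B
firstOf≡1 (no ¬a) (yes b) _ = ¬a , b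
firstOf≡1 (no _)  (no _)  ()

firstOf≡2 : ∀ {A B : Set} (a? : Dec A) (b? : Dec B) → firstOf a? b? ≡ suc (suc zero) → ¬ B
firstOf≡2 (no _) (no ¬b) _ = ¬b
firstOf≡2 (no _) (yes _) ()

module _ {p q n N : ℕ} .{{_ : NonZero p}} .{{_ : NonZero q}}
         (p<n : p < n) (q<n : q < n) (N≤ : N ≤ p * p * q) where

  block row : Fin N → ℕ
  block x = toℕ x / q
  row x   = block x / p

  sameBlock? : ∀ x y → Dec (block x ≡ block y)
  sameBlock? x y = block x ≟ block y

  sameRow? : ∀ x y → Dec (row x ≡ row y)
  sameRow? x y = row x ≟ row y

  -- Vertices are numbered so that the cells are the blocks of q consecutive numbers and the rows
  -- are p consecutive blocks.
  gridColouring : EdgeColouring 3 N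
  gridColouring = record
    { colour = λ x y → firstOf (sameBlock? x y) (sameRow? x y)
    ; sym    = λ x y → firstOf-cong (sameBlock? x y) (sameBlock? y x) (sameRow? x y) (sameRow? y x)
                         sym sym sym sym
    }

  no-copy : ¬ MonochromaticCopy (starredClique p q n) gridColouring
  no-copy (k , φ , mono) = absurd k mono
    where
    f : Fin n → Fin N
    f = Injection.to φ

    clique-vertex : Fin (suc p) → Fin n
    clique-vertex i = inject≤ i p<n

    star-vertex : Fin (suc q) → Fin n
    star-vertex i = inject≤ i q<n

    clique-adj : ∀ {i j} → i ≢ j → Graph.Adj (starredClique p q n) (clique-vertex i) (clique-vertex j)
    clique-adj {i} {j} i≢j = i≢j ∘ Fin.inject≤-injective p<n p<n i j , inj₁ (bound i , bound j)
      where
      bound : ∀ i → toℕ (clique-vertex i) ≤ p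
      bound i = ≤-trans (≤-reflexive (Fin.toℕ-inject≤ i p<n)) (Fin.toℕ≤pred[n] i)

    star-adj : ∀ {j} → j ≢ zero → Graph.Adj (starredClique p q n) (star-vertex j) (star-vertex zero)
    star-adj {j} j≢0 = j≢0 ∘ Fin.inject≤-injective q<n q<n j zero , inj₂ (inj₂ (bound j , Fin.toℕ-inject≤ zero q<n))
      where
      bound : ∀ i → toℕ (star-vertex i) ≤ q
      bound i = ≤-trans (≤-reflexive (Fin.toℕ-inject≤ i q<n)) (Fin.toℕ≤pred[n] i)

    row< : ∀ x → row x < p
    row< x = m<n*o⇒m/o<n (m<n*o⇒m/o<n (<-≤-trans (Fin.toℕ<n x) N≤))

    absurd : ∀ k → ¬ (∀ u v → Graph.Adj (starredClique p q n) u v →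
                      EdgeColouring.colour gridColouring (f u) (f v) ≡ k)
    -- The `q + 1` star vertices all lie in the block of the centre, so two with equal residues
    -- modulo `q` coincide.
    absurd zero mono with bounded-collision q (λ i → toℕ (f (star-vertex i)) % q) (λ _ → m%n<n _ q)
    ... | i , j , i≢j , eq = i≢j (Fin.inject≤-injective q<n q<n i j (Injection.injective φ
      (Fin.toℕ-injective (/%-injective q (trans (sameBlock i) (sym (sameBlock j))) eq))))
      where
      sameBlock : ∀ i → block (f (star-vertex i)) ≡ block (f (star-vertex zero))
      sameBlock i with i Fin.≟ zero
      ... | yes refl = refl
      ... | no  i≢0  = firstOf≡0 (sameBlock? _ _) (sameRow? _ _) (mono _ _ (star-adj i≢0))
    -- Two of the `p + 1` clique vertices have block numbers congruent modulo `p`. Lying in one row,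
    -- they share a block, which colour 1 forbids.
    absurd (suc zero) mono with bounded-collision p (λ i → block (f (clique-vertex i)) % p) (λ _ → m%n<n _ p)
    ... | i , j , i≢j , eq with firstOf≡1 (sameBlock? _ _) (sameRow? _ _) (mono _ _ (clique-adj i≢j))
    ...   | block≢ , row≡ = block≢ (/%-injective p row≡ eq)
    -- There are only `p` rows, so two clique vertices share one, which colour 2 forbids.
    absurd (suc (suc zero)) mono with bounded-collision p (λ i → row (f (clique-vertex i))) (λ _ → row< _)
    ... | i , j , i≢j , eq = firstOf≡2 (sameBlock? _ _) (sameRow? _ _) (mono _ _ (clique-adj i≢j)) eq

-- The choice of parameters

n<2^n : ∀ n → n < 2 ^ n
n<2^n zero    = z<s
n<2^n (suc n) = begin-strict
  1 + n            <⟨ +-mono-≤-< (m^n>0 2 n) (n<2^n n) ⟩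
  2 ^ n + 2 ^ n    ≡⟨ cong (2 ^ n +_) (+-identityʳ (2 ^ n)) ⟨
  2 ^ suc n        ∎
  where open ≤-Reasoning

2^⌊log₂n⌋≤n : ∀ n .{{_ : NonZero n}} → 2 ^ ⌊log₂ n ⌋ ≤ n
2^⌊log₂n⌋≤n n = <-rec (λ n → 0 < n → 2 ^ ⌊log₂ n ⌋ ≤ n) step n (n>0 n)
  where
  n>0 : ∀ n .{{_ : NonZero n}} → 0 < n
  n>0 (suc n) = z<s

  step : ∀ n → (∀ {m} → m < n → 0 < m → 2 ^ ⌊log₂ m ⌋ ≤ m) → 0 < n → 2 ^ ⌊log₂ n ⌋ ≤ n
  step 1               rec _ = ≤-refl
  step n@(suc (suc m)) rec _ = begin
    2 ^ ⌊log₂ n ⌋                   ≡⟨ cong (2 ^_) log-n ⟩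
    2 * 2 ^ ⌊log₂ ⌊ n /2⌋ ⌋         ≤⟨ *-monoʳ-≤ 2 (rec (⌊n/2⌋<n (suc m)) z<s) ⟩
    2 * ⌊ n /2⌋                     ≡⟨ cong (⌊ n /2⌋ +_) (+-identityʳ ⌊ n /2⌋) ⟩
    ⌊ n /2⌋ + ⌊ n /2⌋               ≤⟨ +-monoʳ-≤ ⌊ n /2⌋ (⌊n/2⌋≤⌈n/2⌉ n) ⟩
    ⌊ n /2⌋ + ⌈ n /2⌉               ≡⟨ ⌊n/2⌋+⌈n/2⌉≡n n ⟩
    n                               ∎
    where
    open ≤-Reasoning
    log-n : ⌊log₂ n ⌋ ≡ 1 + ⌊log₂ ⌊ n /2⌋ ⌋
    log-n = sym (trans (cong suc (⌊log₂⌊n/2⌋⌋≡⌊log₂n⌋∸1 n))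
      (m+[n∸m]≡n (⌊log₂⌋-mono-≤ {2} {n} (s≤s (s≤s z≤n)))))

-- The divisor 4 makes the Ramsey bound 9 ^ suc p linear in n, as 9 ≤ 2 ^ 4.
cliqueSize starSize : ℕ → ℕ
cliqueSize n = 2 + ⌊log₂ n ⌋ / 4
starSize n = n / cliqueSize n

separatingGraph : ℕ → Graph
separatingGraph n = starredClique (cliqueSize n) (starSize n) n

module _ {n} (8≤n : 8 ≤ n) where
  private
    p = cliqueSize n
    q = starSize n
    a = ⌊log₂ n ⌋ / 4

    n>0 : 0 < n
    n>0 = ≤-trans (s≤s z≤n) 8≤n

    instance
      n-nonZero : NonZero n
      n-nonZero = >-nonZero n>0

  a*4≤log : a * 4 ≤ ⌊log₂ n ⌋
  a*4≤log = m/n*n≤m ⌊log₂ n ⌋ 4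

  p<n : p < n
  -- Both sides are doubled so that the bound `8 ≤ n` absorbs the additive constant and `log n < n`
  -- the rest.
  p<n = *-cancelʳ-≤ (suc p) n 2 (begin
    (3 + a) * 2      ≡⟨ *-distribʳ-+ 2 3 a ⟩
    6 + a * 2        ≤⟨ +-mono-≤ (m≤m+n 6 2) (*-monoʳ-≤ a (m≤m+n 2 2)) ⟩
    8 + a * 4        ≤⟨ +-monoʳ-≤ 8 (≤-trans a*4≤log (<⇒≤ log<n)) ⟩
    8 + n            ≤⟨ +-monoˡ-≤ n 8≤n ⟩
    n + n            ≡⟨ solve 1 (λ n → n :+ n := n :* con 2) refl n ⟩
    n * 2            ∎)
    where
    open ≤-Reasoning
    open +-*-Solver
    log<n : ⌊log₂ n ⌋ < n
    log<n = <-≤-trans (n<2^n ⌊log₂ n ⌋) (2^⌊log₂n⌋≤n n)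

  q<n : q < n
  -- The summand 2 in `cliqueSize` makes the divisor exceed 1.
  q<n = m/n<m n p (s≤s (s≤s z≤n))

  q>0 : 0 < q
  q>0 = m≥n⇒m/n>0 (<⇒≤ p<n)

  n≤p*q+p : n ≤ p * q + p
  n≤p*q+p = begin
    n              ≡⟨ m≡m%n+[m/n]*n n p ⟩
    n % p + q * p  ≤⟨ +-monoˡ-≤ (q * p) (m%n≤n n p) ⟩
    p + q * p      ≡⟨ trans (+-comm p (q * p)) (cong (_+ p) (*-comm q p)) ⟩
    p * q + p      ∎
    where open ≤-Reasoning

  log≤4p : ⌊log₂ n ⌋ ≤ 4 * p
  log≤4p = begin
    ⌊log₂ n ⌋                ≡⟨ m≡m%n+[m/n]*n ⌊log₂ n ⌋ 4 ⟩
    ⌊log₂ n ⌋ % 4 + a * 4    ≤⟨ +-monoˡ-≤ (a * 4) (≤-trans (m%n≤n ⌊log₂ n ⌋ 4) (m≤m+n 4 4)) ⟩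
    8 + a * 4                ≡⟨ solve 1 (λ a → con 8 :+ a :* con 4 := con 4 :* (con 2 :+ a)) refl a ⟩
    4 * p                    ∎
    where
    open ≤-Reasoning
    open +-*-Solver

  -- Since `q` is positive, `n ≤ p * q + p` gives `n ≤ 2pq`. Multiplying by `log n ≤ 4p` produces
  -- the constant 8.
  n*log≤ : n * ⌊log₂ n ⌋ ≤ 8 * (p * p * q)
  n*log≤ = begin
    n * ⌊log₂ n ⌋              ≤⟨ *-mono-≤ n≤p*q+p log≤4p ⟩
    (p * q + p) * (4 * p)      ≤⟨ *-monoˡ-≤ (4 * p) (+-monoʳ-≤ (p * q) (m≤m*n p q {{>-nonZero q>0}})) ⟩
    (p * q + p * q) * (4 * p)
      ≡⟨ solve 2 (λ p q → (p :* q :+ p :* q) :* (con 4 :* p) := con 8 :* (p :* p :* q)) refl p q ⟩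
    8 * (p * p * q)            ∎
    where
    open ≤-Reasoning
    open +-*-Solver

  lower : ∀ M → Arrows 3 M (separatingGraph n) → n * ⌊log₂ n ⌋ ≤ 8 * M
  lower M arrows with M ≤? p * p * q
  ... | yes M≤ = contradiction (arrows (gridColouring {{it}} {{>-nonZero q>0}} p<n q<n M≤))
                   (no-copy {{it}} {{>-nonZero q>0}} p<n q<n M≤)
  ... | no M≰  = ≤-trans n*log≤ (*-monoʳ-≤ 8 (<⇒≤ (≰⇒> M≰)))

  s*s≤4n : suc p * suc q ≤ 4 * n
  s*s≤4n = begin
    suc p * suc q
      ≡⟨ solve 2 (λ p q → (con 1 :+ p) :* (con 1 :+ q) := q :* p :+ (p :+ (q :+ con 1))) refl p q ⟩
    q * p + (p + (q + 1))  ≤⟨ +-mono-≤ (m/n*n≤m n p) (+-mono-≤ (<⇒≤ p<n) (+-mono-≤ (<⇒≤ q<n) n>0)) ⟩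
    n + (n + (n + n))      ≡⟨ solve 1 (λ n → n :+ (n :+ (n :+ n)) := con 4 :* n) refl n ⟩
    4 * n                  ∎
    where
    open ≤-Reasoning
    open +-*-Solver

  -- As `suc p` is `3 + a`, the factor 729 is `9 ^ 3`, and `9 ^ a ≤ 16 ^ a = 2 ^ (4 * a)` is at most
  -- `n` by the choice of `a`.
  3^≤729n : 3 ^ (2 * suc p) ≤ 729 * n
  3^≤729n = begin
    3 ^ (2 * suc p)         ≡⟨ ^-*-assoc 3 2 (suc p) ⟨
    9 ^ (3 + a)             ≡⟨ ^-distribˡ-+-* 9 3 a ⟩
    729 * 9 ^ a             ≤⟨ *-monoʳ-≤ 729 (^-monoˡ-≤ a (m≤m+n 9 7)) ⟩
    729 * 16 ^ a            ≡⟨ cong (729 *_) (^-*-assoc 2 4 a) ⟩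
    729 * 2 ^ (4 * a)       ≡⟨ cong (λ e → 729 * 2 ^ e) (*-comm 4 a) ⟩
    729 * 2 ^ (a * 4)       ≤⟨ *-monoʳ-≤ 729 (^-monoʳ-≤ 2 a*4≤log) ⟩
    729 * 2 ^ ⌊log₂ n ⌋     ≤⟨ *-monoʳ-≤ 729 (2^⌊log₂n⌋≤n n) ⟩
    729 * n                 ∎
    where open ≤-Reasoning

  -- The constant is 737 = 4 + 4 + 729, one term for each summand of `N-large`.
  upper : Arrows 2 (737 * n) (separatingGraph n)
  upper χ = TwoColours.copy χ (m≤n*m n 737) (begin
    suc p * suc q + (suc p * suc q + 3 ^ (2 * suc p))  ≤⟨ +-mono-≤ s*s≤4n (+-mono-≤ s*s≤4n 3^≤729n) ⟩
    4 * n + (4 * n + 729 * n)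
      ≡⟨ solve 1 (λ n → con 4 :* n :+ (con 4 :* n :+ con 729 :* n) := con 737 :* n) refl n ⟩
    737 * n  ∎)
    where
    open ≤-Reasoning
    open +-*-Solver

theorem1p3 : Σ[ G ∈ (ℕ → Graph) ] Σ[ R₂ ∈ (ℕ → ℕ) ] Σ[ R₃ ∈ (ℕ → ℕ) ]
    ( (∀ n → ∣V∣ (G n) ≡ n)
    × (∀ n → IsRamseyNumber 2 (G n) (R₂ n))
    × (∀ n → IsRamseyNumber 3 (G n) (R₃ n))
    × R₂ =O (λ n → n)
    × R₃ =Ω (λ n → n * ⌊log₂ n ⌋) )
theorem1p3 = separatingGraph
  , (λ n → proj₁ (ramseyNumber (separatingGraph n) 1))
  , (λ n → proj₁ (ramseyNumber (separatingGraph n) 2))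
  , (λ _ → refl)
  , (λ n → proj₂ (ramseyNumber (separatingGraph n) 1))
  , (λ n → proj₂ (ramseyNumber (separatingGraph n) 2))
  -- The upper bound uses minimality of the two-colour number; the lower bound uses that the
  -- three-colour number itself arrows.
  , (737 , 8 , λ n 8≤n → proj₂ (proj₂ (ramseyNumber (separatingGraph n) 1)) (737 * n) (upper 8≤n))
  , (8 , 8 , λ n 8≤n → lower 8≤n _ (proj₁ (proj₂ (ramseyNumber (separatingGraph n) 2))))
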